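{- For every Horn formula $\varphi=\bigwedge_{i=1}^n (C_i\to L_i)$ (with $n\ge 1$): (1) $\bot\notin\mathcal A(\varphi,\{\top\})$ if and only if $\varphi$ is satisfiable; (2) $\bot\in\mathcal A(\varphi,\{\top\})$ if and only if $\varphi$ is contradictory.
   Context: Let $P$ be a countable set of propositional symbols. A positive literal is an element of $P\cup\{\bot\}$ (so $\bot$ counts as a positive literal; $\top$ does not, since $\top$ abbreviates $\neg\bot$). A Horn formula is a propositional formula $\varphi=\bigwedge_{i=1}^n (C_i\to L_i)$ with $n\ge 1$, where each $L_i$ is a positive literal and each $C_i$ is either $\top$ or a conjunction $\bigwedge_{j=1}^{k_i}L_{i,j}$ with $k_i\ge 1$ of positive literals. The implications $C_i\to L_i$ are the clauses of $\varphi$. Put $\mathrm{set}(\top)=\{\top\}$ and $\mathrm{set}(\bigwedge_{j=1}^{k}L_j)=\{L_1,\dots,L_k\}$. Write $\varphi\setminus(C_i\to L_i)$ for the formula obtained from $\varphi$ by removing the $i$-th clause; removing the only clause gives the empty conjunction, written $\top$. The function $\mathcal A$ takes a (possibly empty) conjunction $\varphi=\bigwedge_{i=1}^n (C_i\to L_i)$ with $n\ge 0$, where each $L_i$ is a positive literal and each $C_i$ is either $\top$ or a conjunction of one or more positive literals, together with a set $\mathcal C\subseteq P\cup\{\bot,\top\}$, and returns a subset of $P\cup\{\bot,\top\}$, as follows: if $\varphi$ is the empty conjunction, return $\mathcal C$; otherwise, if some clause $C_i\to L_i$ of $\varphi$ satisfies $\mathrm{set}(C_i)\subseteq\mathcal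 C$, choose any such $i$ and return $\mathcal A(\varphi\setminus(C_i\to L_i),\,\mathcal C\cup\{L_i\})$; otherwise return $\mathcal C$. The choice of $i$ is non-deterministic; statements about $\mathcal A(\varphi,\mathcal C)$ are understood to hold for the set returned under every sequence of choices. A valuation is a function $V:P\to\{0,1\}$; satisfaction $V\Vdash\varphi$ is the usual classical one (with $\bot$ always false and $\top$ always true). A formula is satisfiable if some valuation satisfies it, and contradictory if no valuation does. -}

module Defs where

open import Data.Bool.Base using (Bool; true; false; not; _∧_; _∨_)
open import Data.Fin.Base using (Fin)
open import Data.Fin.Properties using (any?)
open import Data.List.Base using (List; []; _∷_; map; length; lookup; removeAt)
open import Data.List.Properties using (length-removeAt)
import Data.List.Membership.Propositional as List
open import Data.List.NonEmpty.Base as List⁺ using (List⁺; foldr₁; toList)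
open import Data.List.Relation.Unary.All as All using (all?)
open import Data.Nat.Base using (ℕ; zero; suc; pred)
open import Data.Product.Base using (∃; _,_)
open import Level using (0ℓ)
open import Relation.Binary.Definitions using (DecidableEquality)
open import Relation.Binary.PropositionalEquality using (_≡_; refl; trans; cong)
open import Relation.Nullary using (¬_; Dec; yes; no)
open import Relation.Nullary.Decidable using (map′; _⊎-dec_)
open import Relation.Unary using (Pred; Decidable; _⊆_; _∪_; ｛_｝)

private
  variable
    P : Set

infixr 7 _∧ᶠ_
infixr 6 _∨ᶠ_
infixr 5 _→ᶠ_

data Formula (P : Set) : Set where
  var            : P → Formula P
  ⊥ᶠ             : Formula P
  ¬ᶠ_            : Formula P → Formula P
  _∧ᶠ_ _∨ᶠ_ _→ᶠ_ : Formula P → Formula P → Formula P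

⊤ᶠ : Formula P
⊤ᶠ = ¬ᶠ ⊥ᶠ

Valuation : Set → Set
Valuation P = P → Bool

eval : Valuation P → Formula P → Bool
eval V (var p)  = V p
eval V ⊥ᶠ       = false
eval V (¬ᶠ φ)   = not (eval V φ)
eval V (φ ∧ᶠ ψ) = eval V φ ∧ eval V ψ
eval V (φ ∨ᶠ ψ) = eval V φ ∨ eval V ψ
eval V (φ →ᶠ ψ) = not (eval V φ) ∨ eval V ψ

infix 4 _⊩_

_⊩_ : Valuation P → Formula P → Set
V ⊩ φ = eval V φ ≡ true

Satisfiable : Formula P → Set
Satisfiable φ = ∃ λ V → V ⊩ φ

Contradictory : Formula P → Set
Contradictory φ = ∀ V → ¬ (V ⊩ φ)

data Literal (P : Set) : Set where
  atom : P → Literal P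
  bot  : Literal P

data Antecedent (P : Set) : Set where
  top : Antecedent P
  ⋀   : List⁺ (Literal P) → Antecedent P

infix 4 _⟶_

record Clause (P : Set) : Set where
  constructor _⟶_
  field
    antecedent : Antecedent P
    consequent : Literal P

open Clause public

Horn : Set → Set
Horn P = List⁺ (Clause P)

literalFormula : Literal P → Formula P
literalFormula (atom p) = var p
literalFormula bot      = ⊥ᶠ

antecedentFormula : Antecedent P → Formula P
antecedentFormula top    = ⊤ᶠ
antecedentFormula (⋀ Ls) = foldr₁ _∧ᶠ_ (List⁺.map literalFormula Ls)

clauseFormula : Clause P → Formula P
clauseFormula (C ⟶ L) = antecedentFormula C →ᶠ literalFormula L

hornFormula : Horn P → Formula P
hornFormula φ = foldr₁ _∧ᶠ_ (List⁺.map clauseFormula φ)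

-- The disjoint union P ∪ {⊥, ⊤}.
data Symbol (P : Set) : Set where
  lit : Literal P → Symbol P
  top : Symbol P

set : Antecedent P → Pred (Symbol P) 0ℓ
set top    = ｛ top ｝
set (⋀ Ls) = λ s → s List.∈ map lit (toList Ls)

-- 𝒜 φ 𝒞 𝒟 says that some sequence of choices makes the non-deterministic
-- procedure, started on the possibly empty conjunction φ and the set 𝒞,
-- return 𝒟.
data 𝒜 {P : Set} : List (Clause P) → Pred (Symbol P) 0ℓ → Pred (Symbol P) 0ℓ → Set₁ where
  empty : ∀ {𝒞} → 𝒜 [] 𝒞 𝒞
  fire  : ∀ {φ 𝒞 𝒟} (i : Fin (length φ)) →
          set (antecedent (lookup φ i)) ⊆ 𝒞 →
          𝒜 (removeAt φ i) (𝒞 ∪ ｛ lit (consequent (lookup φ i)) ｝) 𝒟 →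
          𝒜 φ 𝒞 𝒟
  stuck : ∀ {c φ 𝒞} →
          (∀ i → ¬ (set (antecedent (lookup (c ∷ φ) i)) ⊆ 𝒞)) →
          𝒜 (c ∷ φ) 𝒞 𝒞

module _ (_≟_ : DecidableEquality P) where

  infix 4 _≟ₛ_

  _≟ₛ_ : DecidableEquality (Symbol P)
  lit (atom p) ≟ₛ lit (atom q) = map′ (λ { refl → refl }) (λ { refl → refl }) (p ≟ q)
  lit (atom _) ≟ₛ lit bot      = no λ ()
  lit bot      ≟ₛ lit (atom _) = no λ ()
  lit bot      ≟ₛ lit bot      = yes refl
  lit _        ≟ₛ top          = no λ ()
  top          ≟ₛ lit _        = no λ ()
  top          ≟ₛ top          = yes refl

  set⊆? : ∀ {𝒞 : Pred (Symbol P) 0ℓ} → Decidable 𝒞 → ∀ C → Dec (set C ⊆ 𝒞)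
  set⊆? 𝒞? top    = map′ (λ { t refl → t }) (λ sub → sub refl) (𝒞? top)
  set⊆? 𝒞? (⋀ Ls) = map′ (λ all → All.lookup all) (λ sub → All.tabulate sub)
                         (all? 𝒞? (map lit (toList Ls)))

  -- 𝒜 always returns something, so quantifying over its possible results is
  -- not vacuous.
  𝒜-total : ∀ φ {𝒞 : Pred (Symbol P) 0ℓ} → Decidable 𝒞 → ∃ (𝒜 φ 𝒞)
  𝒜-total φ = go (length φ) φ refl
    where
    go : ∀ n φ → length φ ≡ n → ∀ {𝒞 : Pred (Symbol P) 0ℓ} → Decidable 𝒞 → ∃ (𝒜 φ 𝒞)
    go zero    []      _  𝒞? = _ , empty
    go (suc n) (c ∷ φ) eq 𝒞?
      with any? (λ i → set⊆? 𝒞? (antecedent (lookup (c ∷ φ) i)))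
    ... | no  none      = _ , stuck (λ i sub → none (i , sub))
    ... | yes (i , sub) =
      let L       = lit (consequent (lookup (c ∷ φ) i))
          𝒟 , run = go n (removeAt (c ∷ φ) i)
                       (trans (length-removeAt (c ∷ φ) i) (cong pred eq))
                       (λ s → 𝒞? s ⊎-dec (L ≟ₛ s))
      in  𝒟 , fire i sub run

{-# OPTIONS --safe #-}

-- Every run of 𝒜 from 𝒞 returns the least superset of 𝒞 closed under the
-- clauses of φ.  The symbols true under a valuation V form a set containing ⊤
-- but not ⊥, which is closed exactly when V ⊩ φ; so the result of a run
-- contains only symbols true in every model of φ, and if it avoids ⊥ it is
-- itself the set of symbols true in some model.
module Submission where

open import Data.Bool.Base using (true; false; _∧_)
open import Data.Bool.Properties using (∧-conicalˡ; ∧-conicalʳ)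
open import Data.Fin.Base using (zero; suc)
open import Data.List.Base using (List; []; _∷_; lookup; removeAt)
open import Data.List.Membership.Propositional.Properties using (∈-lookup)
open import Data.List.NonEmpty.Base as List⁺ using (_∷_; foldr₁; toList)
open import Data.List.Relation.Unary.All as All using (All; []; _∷_)
open import Data.List.Relation.Unary.All.Properties using (map⁺; map⁻)
open import Data.Nat.Base using (ℕ)
open import Data.Nat.Properties using (eq?)
open import Data.Product.Base using (_×_; _,_)
open import Data.Sum.Base using (inj₁; inj₂)
open import Function.Base using (_∘_)
open import Function.Bundles using (_↣_; _⇔_; mk⇔)
open import Level using (0ℓ)
open import Relation.Binary.Definitions using (DecidableEquality)
open import Relation.Binary.PropositionalEquality using (refl; cong₂)
open import Relation.Nullary using (does; yes; contradiction)
open import Relation.Nullary.Decidable using (decidable-stable; dec-true; _⊎-dec_)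
open import Relation.Unary using (Pred; Decidable; _∈_; _∉_; _⊆_; ｛_｝)
open import Defs

private
  variable
    A P : Set
    φ : List (Clause P)
    𝒞 𝒟 𝒮 𝒯 : Pred (Symbol P) 0ℓ

module _ {Q : Pred A 0ℓ} where

  removeAt⁺ : ∀ {xs} i → All Q xs → All Q (removeAt xs i)
  removeAt⁺ zero    (_ ∷ qs) = qs
  removeAt⁺ (suc i) (q ∷ qs) = q ∷ removeAt⁺ i qs

  removeAt⁻ : ∀ {xs} i → Q (lookup xs i) → All Q (removeAt xs i) → All Q xs
  removeAt⁻ {_ ∷ _} zero    q qs        = q ∷ qs
  removeAt⁻ {_ ∷ _} (suc i) q (q′ ∷ qs) = q′ ∷ removeAt⁻ i q qs

  lookup⁻ : ∀ {xs} → (∀ i → Q (lookup xs i)) → All Q xs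
  lookup⁻ {[]}    q = []
  lookup⁻ {_ ∷ _} q = q zero ∷ lookup⁻ (q ∘ suc)

Closed : Pred (Symbol P) 0ℓ → Clause P → Set
Closed 𝒮 c = set (antecedent c) ⊆ 𝒮 → lit (consequent c) ∈ 𝒮

-- The set occurs in both the premise and the conclusion of `Closed`, so closure is neither monotone
-- nor antitone, and the transport takes both inclusions.
Closed-resp-≐ : 𝒮 ⊆ 𝒯 → 𝒯 ⊆ 𝒮 → ∀ c → Closed 𝒮 c → Closed 𝒯 c
Closed-resp-≐ 𝒮⊆𝒯 𝒯⊆𝒮 _ closed sub = 𝒮⊆𝒯 (closed (λ s∈ → 𝒯⊆𝒮 (sub s∈)))

𝒜-extensive : 𝒜 φ 𝒞 𝒟 → 𝒞 ⊆ 𝒟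
𝒜-extensive empty          s∈𝒞 = s∈𝒞
𝒜-extensive (fire _ _ run) s∈𝒞 = 𝒜-extensive run (inj₁ s∈𝒞)
𝒜-extensive (stuck _)      s∈𝒞 = s∈𝒞

-- Firing a clause adds its consequent, and later steps only enlarge the set. A clause left over in
-- a stuck run has an antecedent not contained in the result, so its closure is vacuous.
𝒜-closed : 𝒜 φ 𝒞 𝒟 → All (Closed 𝒟) φ
𝒜-closed empty          = []
𝒜-closed (fire i _ run) = removeAt⁻ i (λ _ → 𝒜-extensive run (inj₂ refl)) (𝒜-closed run)
𝒜-closed (stuck none)   = lookup⁻ λ i sub → contradiction (λ {_} → sub) (none i)

-- Induction on the run with invariant `𝒞 ⊆ 𝒮`: the antecedent of a fired clause then lies in `𝒮`,
-- so closure of `𝒮` puts the added consequent there too.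
𝒜-least : 𝒜 φ 𝒞 𝒟 → All (Closed 𝒮) φ → 𝒞 ⊆ 𝒮 → 𝒟 ⊆ 𝒮
𝒜-least empty            _      𝒞⊆𝒮 = 𝒞⊆𝒮
𝒜-least (stuck _)        _      𝒞⊆𝒮 = 𝒞⊆𝒮
𝒜-least (fire i sub run) closed 𝒞⊆𝒮 = 𝒜-least run (removeAt⁺ i closed) λ where
  (inj₁ s∈𝒞)  → 𝒞⊆𝒮 s∈𝒞
  (inj₂ refl) → All.lookup closed (∈-lookup i) (λ s∈ → 𝒞⊆𝒮 (sub s∈))

-- Each firing adjoins one symbol, recognised by an equality test. This is what lets the result
-- define a Boolean valuation constructively.
𝒜-decidable : DecidableEquality P → {𝒞 : Pred (Symbol P) 0ℓ} → 𝒜 φ 𝒞 𝒟 → Decidable 𝒞 → Decidable 𝒟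
𝒜-decidable _≟_ empty          𝒞? = 𝒞?
𝒜-decidable _≟_ (stuck _)      𝒞? = 𝒞?
𝒜-decidable _≟_ (fire _ _ run) 𝒞? = 𝒜-decidable _≟_ run λ s → 𝒞? s ⊎-dec _≟ₛ_ _≟_ _ s

module _ (V : Valuation P) where

  Holds : Pred (Symbol P) 0ℓ
  Holds (lit L) = V ⊩ literalFormula L
  Holds top     = V ⊩ ⊤ᶠ

  ⊩-⋀⁺ : (f : A → Formula P) (x : A) (xs : List A) →
         All (λ x → V ⊩ f x) (x ∷ xs) → V ⊩ foldr₁ _∧ᶠ_ (List⁺.map f (x ∷ xs))
  ⊩-⋀⁺ f x []       (p ∷ []) = p
  ⊩-⋀⁺ f x (y ∷ xs) (p ∷ ps) = cong₂ _∧_ p (⊩-⋀⁺ f y xs ps)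

  ⊩-⋀⁻ : (f : A → Formula P) (x : A) (xs : List A) →
         V ⊩ foldr₁ _∧ᶠ_ (List⁺.map f (x ∷ xs)) → All (λ x → V ⊩ f x) (x ∷ xs)
  ⊩-⋀⁻ f x []       p = p ∷ []
  ⊩-⋀⁻ f x (y ∷ xs) p = ∧-conicalˡ _ _ p ∷ ⊩-⋀⁻ f y xs (∧-conicalʳ _ _ p)

  ⊩-antecedent⁺ : ∀ C → set C ⊆ Holds → V ⊩ antecedentFormula C
  ⊩-antecedent⁺ top          sub = refl
  ⊩-antecedent⁺ (⋀ (L ∷ Ls)) sub = ⊩-⋀⁺ literalFormula L Ls (map⁻ (All.tabulate sub))

  ⊩-antecedent⁻ : ∀ C → V ⊩ antecedentFormula C → set C ⊆ Holds
  ⊩-antecedent⁻ top          _ refl = refl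
  ⊩-antecedent⁻ (⋀ (L ∷ Ls)) p s∈   = All.lookup {P = Holds} (map⁺ (⊩-⋀⁻ literalFormula L Ls p)) s∈

  ⊩-clause⁺ : ∀ c → Closed Holds c → V ⊩ clauseFormula c
  ⊩-clause⁺ (C ⟶ L) closed with eval V (antecedentFormula C) in eq
  ... | true  = closed (⊩-antecedent⁻ C eq)
  ... | false = refl

  ⊩-clause⁻ : ∀ c → V ⊩ clauseFormula c → Closed Holds c
  -- Once the antecedent evaluates to `true`, the implication computes to its consequent.
  ⊩-clause⁻ (C ⟶ L) p sub rewrite ⊩-antecedent⁺ C sub = p

  ⊩-horn⁺ : ∀ φ → All (Closed Holds) (toList φ) → V ⊩ hornFormula φ
  ⊩-horn⁺ (c ∷ cs) closed = ⊩-⋀⁺ clauseFormula c cs (All.map (λ {c} → ⊩-clause⁺ c) closed)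

  ⊩-horn⁻ : ∀ φ → V ⊩ hornFormula φ → All (Closed Holds) (toList φ)
  ⊩-horn⁻ (c ∷ cs) p = All.map (λ {c} → ⊩-clause⁻ c) (⊩-⋀⁻ clauseFormula c cs p)

characteristic : {𝒟 : Pred (Symbol P) 0ℓ} → Decidable 𝒟 → Valuation P
characteristic 𝒟? p = does (𝒟? (lit (atom p)))

module _ {𝒟 : Pred (Symbol P) 0ℓ} (𝒟? : Decidable 𝒟) where

  ⊆-Holds-characteristic : lit bot ∉ 𝒟 → 𝒟 ⊆ Holds (characteristic 𝒟?)
  ⊆-Holds-characteristic ⊥∉𝒟 {lit (atom p)} s∈𝒟 = dec-true (𝒟? _) s∈𝒟
  ⊆-Holds-characteristic ⊥∉𝒟 {lit bot}      s∈𝒟 = contradiction s∈𝒟 ⊥∉𝒟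
  ⊆-Holds-characteristic ⊥∉𝒟 {top}          s∈𝒟 = refl

  Holds-characteristic-⊆ : top ∈ 𝒟 → Holds (characteristic 𝒟?) ⊆ 𝒟
  -- In the `no` case, and likewise for `lit bot`, `h` would have the empty type `false ≡ true`.
  Holds-characteristic-⊆ ⊤∈𝒟 {lit (atom p)} h with yes s∈𝒟 ← 𝒟? (lit (atom p)) = s∈𝒟
  Holds-characteristic-⊆ ⊤∈𝒟 {top}          h = ⊤∈𝒟

theorem3p6 : {P : Set} → P ↣ ℕ → (φ : Horn P) (𝒟 : Pred (Symbol P) 0ℓ) → 𝒜 (toList φ) ｛ top ｝ 𝒟 →
    ((lit bot ∉ 𝒟) ⇔ Satisfiable (hornFormula φ)) × ((lit bot ∈ 𝒟) ⇔ Contradictory (hornFormula φ))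
theorem3p6 P↣ℕ φ 𝒟 run =
  mk⇔ satisfiable (λ (V , V⊩φ) ⊥∈𝒟 → contradictory ⊥∈𝒟 V V⊩φ) ,
  mk⇔ contradictory λ unsat →
    -- A model built from `⊥∉𝒟` refutes `unsat`; decidability of `𝒟` removes the resulting double
    -- negation.
    decidable-stable (𝒟? (lit bot)) λ ⊥∉𝒟 → let V , V⊩φ = satisfiable ⊥∉𝒟 in unsat V V⊩φ
  where
  𝒟? : Decidable 𝒟
  -- The injection into `ℕ` supplies decidable equality on `P`; the initial set is decided by
  -- comparison with `top`.
  𝒟? = 𝒜-decidable (eq? P↣ℕ) run (_≟ₛ_ (eq? P↣ℕ) top)

  satisfiable : lit bot ∉ 𝒟 → Satisfiable (hornFormula φ)
  satisfiable ⊥∉𝒟 = V , ⊩-horn⁺ V φ (All.map (λ {c} → closed c) (𝒜-closed run))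
    where
    V = characteristic 𝒟?

    closed : ∀ c → Closed 𝒟 c → Closed (Holds V) c
    closed = Closed-resp-≐ (⊆-Holds-characteristic 𝒟? ⊥∉𝒟)
                           -- `top` is in the initial set, hence in `𝒟`.
                           (Holds-characteristic-⊆ 𝒟? (𝒜-extensive run refl))

  contradictory : lit bot ∈ 𝒟 → Contradictory (hornFormula φ)
  -- Leastness against the closed set `Holds V` would make `lit bot` true under `V`, that is,
  -- `false ≡ true`.
  contradictory ⊥∈𝒟 V V⊩φ
    with () ← 𝒜-least {𝒮 = Holds V} run (⊩-horn⁻ V φ V⊩φ) (λ { refl → refl }) ⊥∈𝒟
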